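{- Let the labels $T^{s}_{r,d,X}$ be as defined in the context, computed from the all-one $n$-grid with $n$ sufficiently large. For each even integer $e \ge 0$ there exist rational functions $G_e$ and $G_{e+1}$, each in $\frac{e}{2}+1$ variables and depending only on $e$ (not on $k$ or $n$), such that for every integer $k \ge 0$: $$T^{\frac{e}{2}+2+k}_{e+3+2k,\,2+k,\,L} = G_{e}\Big(T^{1+k}_{1+2k,1+k,L},\ T^{2+k}_{3+2k,1+k,L},\ \dots,\ T^{\frac{e}{2}+1+k}_{e+1+2k,1+k,L}\Big),$$ and $$T^{\frac{e}{2}+2+k}_{e+3+2k,\,1+k,\,R} = G_{e+1}\Big(T^{1+k}_{1+2k,1+k,L},\ T^{2+k}_{3+2k,1+k,L},\ \dots,\ T^{\frac{e}{2}+1+k}_{e+1+2k,1+k,L}\Big).$$ (The arguments are $T^{j+k}_{2j-1+2k,\,1+k,\,L}$ for $j=1,\dots,\frac{e}{2}+1$.)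
   Context: The triangular $m$-grid consists of $m$ rows of upright unit triangles in the triangular lattice, row $r$ ($1\le r\le m$, counted top to bottom) containing $r$ upright triangles $T_{r,d}$, $1\le d\le r$, numbered left to right ($d$ is called the diagonal). Every edge of the grid is the left ($L$), right ($R$) or base ($B$) edge of exactly one upright triangle. Each edge carries a positive real label (a resistance). The all-one $n$-grid has every label equal to $1$. Reduction of a labeled $m$-grid ($m\ge2$) to a labeled $(m-1)$-grid: (1) replace each upright triangle with edge labels $a,b,c$ by a star with a new center vertex, the star edge to a vertex $v$ of the triangle getting label (product of the two triangle labels at $v$)$/(a+b+c)$ (the $\Delta$-$Y$ transformation); (2) delete the three pendant star edges at the three corner vertices of the grid; (3) each non-corner boundary vertex of the original grid now has degree 2: replace its two edges by one edge whose label is the sum of the two labels (series); (4) each interior vertex of the original grid now is the center of a claw whose three edges go to star centers with labels $x_1,x_2,x_3$: replace it by a triangle on those three star centers, the edge between the leaves of $x_i,x_j$ getting label $(x_1x_2+x_2x_3+x_3x_1)/x_k$ where $\{i,j,k\}=\{1,2,3\}$ ($Y$-$\Delta$). The result is a labeled $(m-1)$-grid whose upright triangle $T_{r,d}$ has as vertices the star centers of the parent triangles $T_{r,d}$ (top), $T_{r+1,d}$ (bottom left), $T_{r+1,d+1}$ (bottom right). $T^{s}_{r,d,X}$ ($X\in\{L,R,B\}$) denotes the label of edge $X$ of triangle $T_{r,d}$ in the $(n-s)$-grid obtained from the all-one $n$-grid by $s$ successive reductions. -}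

module Defs where

open import Data.Nat using (ℕ; zero; suc; _∸_; _≤?_)
open import Data.Fin using (Fin)
open import Data.Product using (_×_; _,_)
open import Data.Rational using (ℚ; 0ℚ; 1ℚ; _+_; _*_; _÷_; _≟_; ≢-nonZero)
open import Relation.Nullary using (yes; no)

data Edge : Set where
  L R B : Edge

-- Division on ℚ, total: x / 0 := 0 (never used on 0, since all labels
-- arising from the all-one grid are positive).
infixl 7 _/'_
_/'_ : ℚ → ℚ → ℚ
p /' q with q ≟ 0ℚ
... | yes _   = 0ℚ
... | no q≢0  = _÷_ p q {{≢-nonZero q≢0}}

-- A labeled grid: label r d X of edge X of upright triangle T_{r,d}
-- (values outside 1 ≤ d ≤ r ≤ m are irrelevant).
Lab : Set
Lab = ℕ → ℕ → Edge → ℚ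

module _ (g : Lab) where
  S : ℕ → ℕ → ℚ
  S r d = g r d L + g r d R + g r d B
  -- Δ-Y star edges of T_{r,d}: to top, bottom-left, bottom-right vertex.
  ytop ybl ybr : ℕ → ℕ → ℚ
  ytop r d = g r d L * g r d R /' S r d
  ybl  r d = g r d L * g r d B /' S r d
  ybr  r d = g r d R * g r d B /' S r d
  -- Y-Δ at interior vertex (i,j) (1 ≤ j ≤ i-1): claw edges
  -- x1 = ybr(i,j), x2 = ybl(i,j+1), x3 = ytop(i+1,j+1).
  P : ℕ → ℕ → ℚ
  P i j = ybr i j * ybl i (suc j) + ybl i (suc j) * ytop (suc i) (suc j)
          + ytop (suc i) (suc j) * ybr i j

-- One reduction step of a labeled m-grid to an (m-1)-grid.
-- Vertex (i,j), 0 ≤ j ≤ i ≤ m; T_{r,d} has top (r-1,d-1),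
-- bottom-left (r,d-1), bottom-right (r,d).
reduce : ℕ → Lab → Lab
-- L edge of new T_{r,d}: through old vertex (r,d-1)
reduce m g r zero    L = 0ℚ
reduce m g r (suc zero) L = ybl g r 1 + ytop g (suc r) 1      -- left boundary (series)
reduce m g r (suc (suc d')) L = P g r (suc d') /' ybr g r (suc d')   -- interior, /x1
-- R edge of new T_{r,d}: through old vertex (r,d)
reduce m g r d R with r ≤? d
... | yes _ = ybr g r d + ytop g (suc r) (suc d)               -- right boundary (d = r)
... | no  _ = P g r d /' ybl g r (suc d)                        -- interior, /x2
-- B edge of new T_{r,d}: through old vertex (r+1,d)
reduce m g r d B with m ≤? suc r
... | yes _ = ybr g (suc r) d + ybl g (suc r) (suc d)           -- bottom boundary (r+1 = m)
... | no  _ = P g (suc r) d /' ytop g (suc (suc r)) (suc d)     -- interior, /x3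

grid : ℕ → ℕ → Lab
grid n zero    = λ _ _ _ → 1ℚ
grid n (suc s) = reduce (n ∸ s) (grid n s)

T : ℕ → ℕ → ℕ → ℕ → Edge → ℚ
T n s r d X = grid n s r d X

data Poly (m : ℕ) : Set where
  con : ℚ → Poly m
  var : Fin m → Poly m
  _⊕_ : Poly m → Poly m → Poly m
  _⊗_ : Poly m → Poly m → Poly m

eval : ∀ {m} → Poly m → (Fin m → ℚ) → ℚ
eval (con c) v = c
eval (var i) v = v i
eval (p ⊕ q) v = eval p v + eval q v
eval (p ⊗ q) v = eval p v * eval q v

-- A rational function in m variables, as numerator / denominator.
RatFun : ℕ → Set
RatFun m = Poly m × Poly m

{-# OPTIONS --safe #-}
-- Far from the right and bottom sides the grid looks like a half-plane bounded
-- by its left side: labels no longer depend on the row, and the reflection of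
-- the half-plane makes R and B labels equal.  Write ℓ, ρ for the half-plane
-- labels.  Labels not yet reached by the boundary are 1, and one reduction
-- expresses ρ on diagonal d and ℓ on diagonal d + 1 through the previous labels
-- of diagonals d and d + 1.  Induction on the age of a diagonal (reductions
-- since the boundary reached it) then eliminates everything but ℓ on diagonal d.
module Submission where

open import Defs
open import Data.Nat using (ℕ; zero; suc; _+_; _*_; _≤_; _<_; _≤?_; _∸_; z≤n; s≤s; s≤s⁻¹)
open import Data.Nat.Properties using (+-suc; +-comm; +-monoʳ-≤; +-monoˡ-≤; *-monoˡ-≤; m≤m*n; m≤n+m; m+n≤o⇒m≤o∸n; m≤n⇒m<n∨m≡n; ≤-trans; ≤-refl; ≤-reflexive; n≤1+n; <⇒≤; <⇒≱; module ≤-Reasoning)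
open import Data.Nat.Tactic.RingSolver using (solve-∀)
open import Data.Fin using (Fin; toℕ; fromℕ<)
open import Data.Fin.Properties using (toℕ-fromℕ<; toℕ≤pred[n])
open import Data.Product using (Σ; _×_; _,_; ∃; proj₁; proj₂)
open import Data.Rational using (ℚ; 0ℚ; 1ℚ; 1/_; positive; ≢-nonZero; _≟_) renaming (_*_ to _*ℚ_; _+_ to _+ℚ_; _<_ to _<ℚ_)
import Data.Rational.Properties as ℚ
open import Data.Rational.Solver using (module +-*-Solver)
open import Data.Sum using (inj₁; inj₂)
open import Function using (_∘_)
open import Relation.Nullary using (yes; no; contradiction)
open import Relation.Binary.PropositionalEquality using (_≡_; _≢_; refl; sym; trans; cong; cong₂; subst; module ≡-Reasoning)

-- Division and positivity of rationals.

/'-*-cancel : ∀ x {y} → y ≢ 0ℚ → (x /' y) *ℚ y ≡ x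
/'-*-cancel x {y} y≢0 with y ≟ 0ℚ
... | yes y≡0 = contradiction y≡0 y≢0
... | no y≢0′ = let instance _ = ≢-nonZero y≢0′ in begin
  x *ℚ 1/ y *ℚ y    ≡⟨ ℚ.*-assoc x (1/ y) y ⟩
  x *ℚ (1/ y *ℚ y)  ≡⟨ cong (x *ℚ_) (ℚ.*-inverseˡ y) ⟩
  x *ℚ 1ℚ           ≡⟨ ℚ.*-identityʳ x ⟩
  x                 ∎
  where open ≡-Reasoning

*-≢0 : ∀ {x y} → x ≢ 0ℚ → y ≢ 0ℚ → x *ℚ y ≢ 0ℚ
*-≢0 {x} {y} x≢0 y≢0 xy≡0 = let instance _ = ≢-nonZero y≢0 in x≢0 (begin
  x                  ≡⟨ ℚ.*-identityʳ x ⟨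
  x *ℚ 1ℚ            ≡⟨ cong (x *ℚ_) (ℚ.*-inverseʳ y) ⟨
  x *ℚ (y *ℚ 1/ y)   ≡⟨ ℚ.*-assoc x y (1/ y) ⟨
  x *ℚ y *ℚ 1/ y     ≡⟨ cong (_*ℚ 1/ y) xy≡0 ⟩
  0ℚ *ℚ 1/ y         ≡⟨ ℚ.*-zeroˡ (1/ y) ⟩
  0ℚ                 ∎)
  where open ≡-Reasoning

>0⇒≢0 : ∀ {x} → 0ℚ <ℚ x → x ≢ 0ℚ
>0⇒≢0 0<x x≡0 = ℚ.<⇒≢ 0<x (sym x≡0)

+->0 : ∀ {x y} → 0ℚ <ℚ x → 0ℚ <ℚ y → 0ℚ <ℚ x +ℚ y
+->0 = ℚ.+-mono-<

*->0 : ∀ {x y} → 0ℚ <ℚ x → 0ℚ <ℚ y → 0ℚ <ℚ x *ℚ y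
*->0 {x} {y} 0<x 0<y = ℚ.positive⁻¹ (x *ℚ y) {{ℚ.pos*pos⇒pos x {{positive 0<x}} y {{positive 0<y}}}}

/'->0 : ∀ {x y} → 0ℚ <ℚ x → 0ℚ <ℚ y → 0ℚ <ℚ x /' y
/'->0 {x} {y} 0<x 0<y with y ≟ 0ℚ
... | yes y≡0 = contradiction y≡0 (>0⇒≢0 0<y)
... | no y≢0 = *->0 0<x (ℚ.positive⁻¹ _ {{ℚ.1/pos⇒pos y {{positive 0<y}}}})

-- Labels of the half-plane

-- Star edges of a triangle with labels L = a and R = B = b: the edges to the two
-- vertices on the left side coincide.
starLeft starRight : ℚ → ℚ → ℚ
starLeft a b = a *ℚ b /' (a +ℚ b +ℚ b)
starRight a b = b *ℚ b /' (a +ℚ b +ℚ b)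

-- The Y-Δ numerator at an interior vertex: `z` is the star edge from the triangle on the left
-- diagonal, `y` the common value of the two edges from the next diagonal, which coincide because R
-- = B.
claw : ℚ → ℚ → ℚ
claw z y = z *ℚ y +ℚ y *ℚ y +ℚ y *ℚ z

-- The second argument is the zero-based diagonal d − 1.
ℓ ρ yˡ yʳ : ℕ → ℕ → ℚ
ℓ zero    e       = 1ℚ
ℓ (suc s) zero    = yˡ s 0 +ℚ yˡ s 0
ℓ (suc s) (suc e) = claw (yʳ s e) (yˡ s (suc e)) /' yʳ s e
ρ zero    e       = 1ℚ
ρ (suc s) e       = claw (yʳ s e) (yˡ s (suc e)) /' yˡ s (suc e)
yˡ s e = starLeft (ℓ s e) (ρ s e)
yʳ s e = starRight (ℓ s e) (ρ s e)

claw->0 : ∀ {z y} → 0ℚ <ℚ z → 0ℚ <ℚ y → 0ℚ <ℚ claw z y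
claw->0 0<z 0<y = +->0 (+->0 (*->0 0<z 0<y) (*->0 0<y 0<y)) (*->0 0<y 0<z)

-- Positivity ensures that no division in the recursion falls back on the default value 0 of `/'`;
-- `def-/` needs this for every denominator.
ℓ->0 : ∀ s e → 0ℚ <ℚ ℓ s e
ρ->0 : ∀ s e → 0ℚ <ℚ ρ s e
S->0 : ∀ s e → 0ℚ <ℚ ℓ s e +ℚ ρ s e +ℚ ρ s e
yˡ->0 : ∀ s e → 0ℚ <ℚ yˡ s e
yʳ->0 : ∀ s e → 0ℚ <ℚ yʳ s e
ℓ->0 zero    e       = ℚ.positive⁻¹ 1ℚ
ℓ->0 (suc s) zero    = +->0 (yˡ->0 s 0) (yˡ->0 s 0)
ℓ->0 (suc s) (suc e) = /'->0 (claw->0 (yʳ->0 s e) (yˡ->0 s (suc e))) (yʳ->0 s e)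
ρ->0 zero    e       = ℚ.positive⁻¹ 1ℚ
ρ->0 (suc s) e       = /'->0 (claw->0 (yʳ->0 s e) (yˡ->0 s (suc e))) (yˡ->0 s (suc e))
S->0 s e = +->0 (+->0 (ℓ->0 s e) (ρ->0 s e)) (ρ->0 s e)
yˡ->0 s e = /'->0 (*->0 (ℓ->0 s e) (ρ->0 s e)) (S->0 s e)
yʳ->0 s e = /'->0 (*->0 (ρ->0 s e) (ρ->0 s e)) (S->0 s e)

-- The all-one labels are a fixed point of the interior rule, by computation. `ℓ` reads the diagonal
-- to its left while `ρ` reads only its own and the next one, so `ρ` stays 1 for one reduction
-- longer.
ℓ-untouched : ∀ {s e} → s ≤ e → ℓ s e ≡ 1ℚ
ρ-untouched : ∀ {s e} → s ≤ suc e → ρ s e ≡ 1ℚ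
yˡ-untouched : ∀ {s e} → s ≤ e → yˡ s e ≡ starLeft 1ℚ 1ℚ
yʳ-untouched : ∀ {s e} → s ≤ e → yʳ s e ≡ starRight 1ℚ 1ℚ
ℓ-untouched z≤n = refl
ℓ-untouched {suc s} {suc e} (s≤s s≤e) = cong₂ (λ z y → claw z y /' z) (yʳ-untouched s≤e) (yˡ-untouched (≤-trans s≤e (n≤1+n e)))
ρ-untouched z≤n = refl
ρ-untouched {suc s} {e} (s≤s s≤e) = cong₂ (λ z y → claw z y /' y) (yʳ-untouched s≤e) (yˡ-untouched (≤-trans s≤e (n≤1+n e)))
yˡ-untouched {e = e} s≤e = cong₂ starLeft (ℓ-untouched s≤e) (ρ-untouched (≤-trans s≤e (n≤1+n e)))
yʳ-untouched {e = e} s≤e = cong₂ starRight (ℓ-untouched s≤e) (ρ-untouched (≤-trans s≤e (n≤1+n e)))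

-- The grid agrees with the half-plane

-- The case distinction on the diagonal only unblocks the definition of reduce.
reduce-R : ∀ m g {r} d → d < r → reduce m g r d R ≡ P g r d /' ybl g r (suc d)
reduce-R m g {r} zero d<r with r ≤? 0
... | yes r≤d = contradiction r≤d (<⇒≱ d<r)
... | no _ = refl
reduce-R m g {r} (suc zero) d<r with r ≤? 1
... | yes r≤d = contradiction r≤d (<⇒≱ d<r)
... | no _ = refl
reduce-R m g {r} d@(suc (suc _)) d<r with r ≤? d
... | yes r≤d = contradiction r≤d (<⇒≱ d<r)
... | no _ = refl

reduce-B : ∀ {m} g {r} d → suc r < m → reduce m g r d B ≡ P g (suc r) d /' ytop g (suc (suc r)) (suc d)
reduce-B {m} g {r} zero 1+r<m with m ≤? suc r
... | yes m≤1+r = contradiction m≤1+r (<⇒≱ 1+r<m)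
... | no _ = refl
reduce-B {m} g {r} (suc zero) 1+r<m with m ≤? suc r
... | yes m≤1+r = contradiction m≤1+r (<⇒≱ 1+r<m)
... | no _ = refl
reduce-B {m} g {r} (suc (suc _)) 1+r<m with m ≤? suc r
... | yes m≤1+r = contradiction m≤1+r (<⇒≱ 1+r<m)
... | no _ = refl

-- The right side reaches R one reduction earlier than L and B, hence the
-- strict inequality in R≡ρ.  The bound s * 2 + r < n keeps the bottom side away.
record Agrees (n s : ℕ) : Set where
  field
    L≡ℓ : ∀ {r e} → s + e ≤ r → s * 2 + r < n → T n s r (suc e) L ≡ ℓ s e
    R≡ρ : ∀ {r e} → s + e < r → s * 2 + r < n → T n s r (suc e) R ≡ ρ s e
    B≡ρ : ∀ {r e} → s + e ≤ r → s * 2 + r < n → T n s r (suc e) B ≡ ρ s e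

module _ {n s : ℕ} (agrees : Agrees n s) where
  open Agrees agrees

  module _ {r e : ℕ} (lt : s + e < r) (bd : s * 2 + r < n) where
    ytop≡ : ytop (grid n s) r (suc e) ≡ yˡ s e
    ytop≡ rewrite L≡ℓ (<⇒≤ lt) bd | R≡ρ lt bd | B≡ρ (<⇒≤ lt) bd = refl

    ybl≡ : ybl (grid n s) r (suc e) ≡ yˡ s e
    ybl≡ rewrite L≡ℓ (<⇒≤ lt) bd | R≡ρ lt bd | B≡ρ (<⇒≤ lt) bd = refl

    ybr≡ : ybr (grid n s) r (suc e) ≡ yʳ s e
    ybr≡ rewrite L≡ℓ (<⇒≤ lt) bd | R≡ρ lt bd | B≡ρ (<⇒≤ lt) bd = refl

  P≡ : ∀ {i e} → s + suc e < i → s * 2 + suc i < n →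
       P (grid n s) i (suc e) ≡ claw (yʳ s e) (yˡ s (suc e))
  P≡ {i} {e} lt bd
    rewrite ybr≡ {i} {e} (≤-trans (s≤s (+-monoʳ-≤ s (n≤1+n e))) lt) (≤-trans (s≤s (+-monoʳ-≤ (s * 2) (n≤1+n i))) bd)
          | ybl≡ lt (≤-trans (s≤s (+-monoʳ-≤ (s * 2) (n≤1+n i))) bd)
          | ytop≡ (≤-trans lt (n≤1+n i)) bd = refl

agrees-everywhere : ∀ n s → Agrees n s
agrees-everywhere n zero = record { L≡ℓ = λ _ _ → refl ; R≡ρ = λ _ _ → refl ; B≡ρ = λ _ _ → refl }
agrees-everywhere n (suc s) = record { L≡ℓ = L-step ; R≡ρ = R-step ; B≡ρ = B-step }
  where
  ih : Agrees n s
  ih = agrees-everywhere n s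

  -- A new label on row `r` reads old rows `r` and `r + 1`, and for B also `r + 2`. Hence each
  -- reduction costs two rows, the factor 2 in `s * 2 + r < n`.
  row₀ : ∀ {r} → suc s * 2 + r < n → s * 2 + r < n
  row₀ bd = <⇒≤ (<⇒≤ bd)

  row₁ : ∀ {r} → suc s * 2 + r < n → s * 2 + suc r < n
  row₁ {r} bd rewrite +-suc (s * 2) r = <⇒≤ bd

  row₂ : ∀ {r} → suc s * 2 + r < n → s * 2 + suc (suc r) < n
  row₂ {r} bd rewrite +-suc (s * 2) (suc r) | +-suc (s * 2) r = bd

  next : ∀ {e r} → suc s + e < r → s + suc e < r
  next {e} rewrite +-suc s e = λ lt → lt

  L-step : ∀ {r e} → suc s + e ≤ r → suc s * 2 + r < n → T n (suc s) r (suc e) L ≡ ℓ (suc s) e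
  L-step {r} {zero} lt bd = cong₂ _+ℚ_ (ybl≡ ih lt (row₀ bd)) (ytop≡ ih (≤-trans lt (n≤1+n r)) (row₁ bd))
  L-step {r} {suc e} lt bd = cong₂ _/'_ (P≡ ih lt (row₁ bd)) (ybr≡ ih (≤-trans (s≤s (+-monoʳ-≤ s (n≤1+n e))) lt) (row₀ bd))

  R-step : ∀ {r e} → suc s + e < r → suc s * 2 + r < n → T n (suc s) r (suc e) R ≡ ρ (suc s) e
  R-step {r} {e} lt bd = trans
    (reduce-R (n ∸ s) (grid n s) (suc e) (≤-trans (s≤s (s≤s (m≤n+m e s))) lt))
    (cong₂ _/'_ (P≡ ih (next lt) (row₁ bd)) (ybl≡ ih (next lt) (row₀ bd)))

  B-step : ∀ {r e} → suc s + e ≤ r → suc s * 2 + r < n → T n (suc s) r (suc e) B ≡ ρ (suc s) e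
  B-step {r} {e} lt bd = trans
    (reduce-B (grid n s) (suc e) (m+n≤o⇒m≤o∸n (suc (suc r)) 2+r+s≤n))
    (cong₂ _/'_ (P≡ ih (next (s≤s lt)) (row₂ bd)) (ytop≡ ih (next (s≤s (≤-trans lt (n≤1+n r)))) (row₂ bd)))
    where
    -- The grid being reduced has `n ∸ s` rows, so the interior case of B needs `r + 2 ≤ n ∸ s`. The
    -- bound gives more, since `s ≤ s * 2`.
    2+r+s≤n : suc (suc r) + s ≤ n
    2+r+s≤n rewrite +-comm r s = ≤-trans (s≤s (s≤s (+-monoˡ-≤ r (m≤m*n s 2)))) (<⇒≤ bd)

-- Families given by one rational function of the arguments

-- The polynomials are chosen before `κ`, which is the uniformity the theorem asks for. The equation
-- is cross-multiplied, as in the final statement.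
record Definable {I : Set} {m : ℕ} (args : I → Fin m → ℚ) (x : I → ℚ) : Set where
  constructor definable
  field
    {num den}  : Poly m
    represents : ∀ κ → eval den (args κ) ≢ 0ℚ × x κ *ℚ eval den (args κ) ≡ eval num (args κ)

module _ {I : Set} {m : ℕ} {args : I → Fin m → ℚ} where

  open +-*-Solver

  def-resp : ∀ {x x′} → (∀ κ → x κ ≡ x′ κ) → Definable args x → Definable args x′
  def-resp x≡x′ (definable {p} {q} rep) = definable {num = p} {den = q} λ κ → proj₁ (rep κ) , trans (cong (_*ℚ _) (sym (x≡x′ κ))) (proj₂ (rep κ))

  def-const : ∀ c → Definable args (λ _ → c)
  def-const c = definable {num = con c} {den = con 1ℚ} λ κ → (λ ()) , ℚ.*-identityʳ c

  def-var : ∀ i → Definable args (λ κ → args κ i)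
  def-var i = definable {num = var i} {den = con 1ℚ} λ κ → (λ ()) , ℚ.*-identityʳ (args κ i)

  def-+ : ∀ {x y} → Definable args x → Definable args y → Definable args (λ κ → x κ +ℚ y κ)
  def-+ {x} {y} (definable {p} {q} xp) (definable {p′} {q′} yp) = definable {num = (p ⊗ q′) ⊕ (p′ ⊗ q)} {den = q ⊗ q′} λ κ →
    *-≢0 (proj₁ (xp κ)) (proj₁ (yp κ)) ,
    trans (solve 4 (λ a b c d → (a :+ b) :* (c :* d) := (a :* c) :* d :+ (b :* d) :* c) refl
             (x κ) (y κ) (eval q (args κ)) (eval q′ (args κ)))
          (cong₂ (λ a b → a *ℚ _ +ℚ b *ℚ _) (proj₂ (xp κ)) (proj₂ (yp κ)))

  def-* : ∀ {x y} → Definable args x → Definable args y → Definable args (λ κ → x κ *ℚ y κ)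
  def-* {x} {y} (definable {p} {q} xp) (definable {p′} {q′} yp) = definable {num = p ⊗ p′} {den = q ⊗ q′} λ κ →
    *-≢0 (proj₁ (xp κ)) (proj₁ (yp κ)) ,
    trans (solve 4 (λ a b c d → (a :* b) :* (c :* d) := (a :* c) :* (b :* d)) refl
             (x κ) (y κ) (eval q (args κ)) (eval q′ (args κ)))
          (cong₂ _*ℚ_ (proj₂ (xp κ)) (proj₂ (yp κ)))

  def-/ : ∀ {x y} → (∀ κ → y κ ≢ 0ℚ) → Definable args x → Definable args y → Definable args (λ κ → x κ /' y κ)
  def-/ {x} {y} y≢0 (definable {p} {q} xp) (definable {p′} {q′} yp) = definable {num = p ⊗ q′} {den = q ⊗ p′} λ κ →
    let v = args κ in
    -- `p′` enters the denominator; its value is `y κ` times the nonzero value of `q′`.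
    *-≢0 (proj₁ (xp κ)) (subst (_≢ 0ℚ) (proj₂ (yp κ)) (*-≢0 (y≢0 κ) (proj₁ (yp κ)))) ,
    (begin
      (x κ /' y κ) *ℚ (eval q v *ℚ eval p′ v)
        ≡⟨ cong (λ u → (x κ /' y κ) *ℚ (eval q v *ℚ u)) (proj₂ (yp κ)) ⟨
      (x κ /' y κ) *ℚ (eval q v *ℚ (y κ *ℚ eval q′ v))
        ≡⟨ solve 4 (λ a b c d → a :* (c :* (b :* d)) := a :* b :* c :* d) refl
             (x κ /' y κ) (y κ) (eval q v) (eval q′ v) ⟩
      (x κ /' y κ) *ℚ y κ *ℚ eval q v *ℚ eval q′ v
        ≡⟨ cong (λ u → u *ℚ eval q v *ℚ eval q′ v) (/'-*-cancel (x κ) (y≢0 κ)) ⟩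
      x κ *ℚ eval q v *ℚ eval q′ v
        ≡⟨ cong (_*ℚ eval q′ v) (proj₂ (xp κ)) ⟩
      eval p v *ℚ eval q′ v ∎)
    where open ≡-Reasoning

  module _ (s e : I → ℕ)
           (dℓ : Definable args (λ κ → ℓ (s κ) (e κ))) (dρ : Definable args (λ κ → ρ (s κ) (e κ))) where

    def-yˡ : Definable args (λ κ → yˡ (s κ) (e κ))
    def-yˡ = def-/ (λ κ → >0⇒≢0 (S->0 (s κ) (e κ))) (def-* dℓ dρ) (def-+ (def-+ dℓ dρ) dρ)

    def-yʳ : Definable args (λ κ → yʳ (s κ) (e κ))
    def-yʳ = def-/ (λ κ → >0⇒≢0 (S->0 (s κ) (e κ))) (def-* dρ dρ) (def-+ (def-+ dℓ dρ) dρ)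

  def-claw : ∀ {z y} → Definable args z → Definable args y → Definable args (λ κ → claw (z κ) (y κ))
  def-claw dz dy = def-+ (def-+ (def-* dz dy) (def-* dy dy)) (def-* dy dz)

  -- With the age of diagonal `e` at time `s` being `s - e`, the induction is on the largest age
  -- `h`. The diagonal is arbitrary because the step also uses the induction hypothesis one diagonal
  -- further right. That use takes `ρ` at age `h`, the other takes it at age `h + 1`; hence both are
  -- in the conclusion.
  definable-next : ∀ h (e : I → ℕ) →
    (∀ i → i ≤ h → Definable args (λ κ → ℓ (i + e κ) (e κ))) →
    (∀ i → i ≤ h → Definable args (λ κ → ℓ (i + suc (e κ)) (suc (e κ))))
      × Definable args (λ κ → ρ (h + e κ) (e κ))
      × Definable args (λ κ → ρ (suc h + e κ) (e κ))
  definable-next zero e _ =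
    (λ { zero z≤n → def-resp (λ κ → sym (ℓ-untouched (≤-refl {suc (e κ)}))) (def-const 1ℚ) }) ,
    def-resp (λ κ → sym (ρ-untouched (n≤1+n (e κ)))) (def-const 1ℚ) ,
    def-resp (λ κ → sym (ρ-untouched (≤-refl {suc (e κ)}))) (def-const 1ℚ)
  definable-next (suc h) e dℓ = ℓ-next , dρ , ρ-next
    where
    ih = definable-next h e (λ i i≤h → dℓ i (≤-trans i≤h (n≤1+n h)))

    dℓ⁺ : ∀ i → i ≤ h → Definable args (λ κ → ℓ (i + suc (e κ)) (suc (e κ)))
    dℓ⁺ = proj₁ ih

    dρ : Definable args (λ κ → ρ (suc h + e κ) (e κ))
    dρ = proj₂ (proj₂ ih)

    -- The second use of the hypothesis, on diagonal `e + 1`, whose `ℓ` up to age `h` the first use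
    -- has just supplied.
    dρ⁺ : Definable args (λ κ → ρ (h + suc (e κ)) (suc (e κ)))
    dρ⁺ = proj₁ (proj₂ (definable-next h (suc ∘ e) dℓ⁺))

    -- At time `h + 1 + e` diagonal `e` has age `h + 1` and diagonal `e + 1` has age `h`. One more
    -- reduction turns `dz` and `dy` into both new labels.
    dz : Definable args (λ κ → yʳ (h + suc (e κ)) (e κ))
    dz = def-resp (λ κ → cong (λ s → yʳ s (e κ)) (sym (+-suc h (e κ)))) (def-yʳ (λ κ → suc h + e κ) e (dℓ (suc h) ≤-refl) dρ)

    dy : Definable args (λ κ → yˡ (h + suc (e κ)) (suc (e κ)))
    dy = def-yˡ (λ κ → h + suc (e κ)) (suc ∘ e) (dℓ⁺ h ≤-refl) dρ⁺

    ρ-next : Definable args (λ κ → ρ (suc (suc h) + e κ) (e κ))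
    ρ-next = def-resp (λ κ → cong (λ s → ρ (suc s) (e κ)) (+-suc h (e κ)))
      (def-/ (λ κ → >0⇒≢0 (yˡ->0 (h + suc (e κ)) (suc (e κ)))) (def-claw dz dy) dy)

    ℓ-next : ∀ i → i ≤ suc h → Definable args (λ κ → ℓ (i + suc (e κ)) (suc (e κ)))
    ℓ-next i i≤1+h with m≤n⇒m<n∨m≡n i≤1+h
    ... | inj₁ i<1+h = dℓ⁺ i (s≤s⁻¹ i<1+h)
    ... | inj₂ refl = def-/ (λ κ → >0⇒≢0 (yʳ->0 (h + suc (e κ)) (e κ))) (def-claw dz dy) dz

-- Specialisation to the labels of the theorem

-- The row bound of `Agrees` at the target labels, where `h` is e/2. The arguments have smaller
-- times and rows, so it covers them too.
bound : ℕ → ℕ → ℕ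
bound h k = suc ((h + 2 + k) * 2 + (2 * h + 3 + 2 * k))

-- Indexing by `n` as well as `k` makes the rational functions independent of both.
record Index (h : ℕ) : Set where
  constructor index
  field
    k n : ℕ
    large : bound h k ≤ n

arguments : ∀ h → Index h → Fin (suc h) → ℚ
arguments h (index k n _) i = T n (suc (toℕ i) + k) (2 * toℕ i + 1 + 2 * k) (1 + k) L

argument≡ℓ : ∀ h κ i → arguments h κ i ≡ ℓ (suc (toℕ i) + Index.k κ) (Index.k κ)
argument≡ℓ h (index k n large) i = Agrees.L≡ℓ (agrees-everywhere n (suc j + k)) in-range (≤-trans (s≤s le) large)
  where
  j : ℕ
  j = toℕ i
  in-range : suc j + k + k ≤ 2 * j + 1 + 2 * k
  in-range = ≤-trans (m≤n+m _ j) (≤-reflexive (eq j k))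
    where
    eq : ∀ j k → j + (suc j + k + k) ≡ 2 * j + 1 + 2 * k
    eq = solve-∀
  j≤h : j ≤ h
  j≤h = toℕ≤pred[n] i
  le : (suc j + k) * 2 + (2 * j + 1 + 2 * k) ≤ (h + 2 + k) * 2 + (2 * h + 3 + 2 * k)
  le = begin
    (suc j + k) * 2 + (2 * j + 1 + 2 * k)        ≡⟨ eq₁ j k ⟩
    j * 4 + (3 + 4 * k)                          ≤⟨ +-monoˡ-≤ _ (*-monoˡ-≤ 4 j≤h) ⟩
    h * 4 + (3 + 4 * k)                          ≤⟨ m≤n+m _ 4 ⟩
    4 + (h * 4 + (3 + 4 * k))                    ≡⟨ eq₂ h k ⟩
    (h + 2 + k) * 2 + (2 * h + 3 + 2 * k)        ∎
    where
    open ≤-Reasoning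
    eq₁ : ∀ j k → (suc j + k) * 2 + (2 * j + 1 + 2 * k) ≡ j * 4 + (3 + 4 * k)
    eq₁ = solve-∀
    eq₂ : ∀ h k → 4 + (h * 4 + (3 + 4 * k)) ≡ (h + 2 + k) * 2 + (2 * h + 3 + 2 * k)
    eq₂ = solve-∀

module _ (h : ℕ) where

  -- The arguments are exactly `ℓ` on diagonal `k` at ages 1 to `h + 1`; age 0 is still untouched,
  -- so it is the constant 1.
  ℓ-definable : ∀ i → i ≤ suc h → Definable (arguments h) (λ κ → ℓ (i + Index.k κ) (Index.k κ))
  ℓ-definable zero    _         = def-resp (λ κ → sym (ℓ-untouched (≤-refl {Index.k κ}))) (def-const 1ℚ)
  ℓ-definable (suc i) 1+i≤1+h = def-resp
    (λ κ → trans (argument≡ℓ h κ (fromℕ< 1+i≤1+h))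
                 (cong (λ j → ℓ (suc j + Index.k κ) (Index.k κ)) (toℕ-fromℕ< 1+i≤1+h)))
    (def-var (fromℕ< 1+i≤1+h))

  target-age : ∀ k → suc h + suc k ≡ h + 2 + k
  target-age = eq h
    where
    eq : ∀ h k → suc h + suc k ≡ h + 2 + k
    eq = solve-∀

  target-L : Definable (arguments h) λ { (index k n _) → T n (h + 2 + k) (2 * h + 3 + 2 * k) (2 + k) L }
  target-L = def-resp eq (proj₁ (definable-next (suc h) Index.k ℓ-definable) (suc h) ≤-refl)
    where
    row : ∀ h k → h + (h + 2 + k + suc k) ≡ 2 * h + 3 + 2 * k
    row = solve-∀
    eq : (κ : Index h) → _
    eq (index k n large) = trans (cong (λ s → ℓ s (suc k)) (target-age k))
      (sym (Agrees.L≡ℓ (agrees-everywhere n (h + 2 + k)) (≤-trans (m≤n+m _ h) (≤-reflexive (row h k))) large))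

  target-R : Definable (arguments h) λ { (index k n _) → T n (h + 2 + k) (2 * h + 3 + 2 * k) (1 + k) R }
  target-R = def-resp eq (proj₂ (proj₂ (definable-next (suc h) Index.k ℓ-definable)))
    where
    row : ∀ h k → h + suc (h + 2 + k + k) ≡ 2 * h + 3 + 2 * k
    row = solve-∀
    eq : (κ : Index h) → _
    eq (index k n large) = trans (cong (λ s → ρ s k) (trans (sym (+-suc (suc h) k)) (target-age k)))
      (sym (Agrees.R≡ρ (agrees-everywhere n (h + 2 + k)) (≤-trans (m≤n+m _ h) (≤-reflexive (row h k))) large))

mainTheorem1 : (h : ℕ) →
    Σ (RatFun (suc h)) λ { (p₀ , q₀) → Σ (RatFun (suc h)) λ { (p₁ , q₁) →
      (k : ℕ) → ∃ λ N → (n : ℕ) → N ≤ n →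
        let args : Fin (suc h) → ℚ
            args i = T n (suc (toℕ i) + k) (2 * toℕ i + 1 + 2 * k) (1 + k) L
        in (eval q₀ args ≢ 0ℚ
            × T n (h + 2 + k) (2 * h + 3 + 2 * k) (2 + k) L *ℚ eval q₀ args ≡ eval p₀ args)
         × (eval q₁ args ≢ 0ℚ
            × T n (h + 2 + k) (2 * h + 3 + 2 * k) (1 + k) R *ℚ eval q₁ args ≡ eval p₁ args) } }
mainTheorem1 h = (num dL , den dL) , (num dR , den dR) , λ k → bound h k , λ n large →
  represents dL (index k n large) , represents dR (index k n large)
  where
  open Definable
  dL = target-L h
  dR = target-R h
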